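{- Let $G$ be a strongly connected $k$-out graph which is totally synchronizing. Then $\operatorname{Aut}(G)$ contains no vertex-rigid automorphism; in particular, $\operatorname{Aut}(G)$ contains no semiregular element.
   Context: A graph is a finite directed multigraph $G=(V,E,s,t)$ with source and target maps $s,t:E\to V$ (loops and parallel edges allowed). It is $k$-out if every vertex has exactly $k$ outgoing edges. An automorphism of $G$ is a pair $\varphi=(\varphi_v,\varphi_e)$ of bijections $V\to V$, $E\to E$ with $s\varphi_e=\varphi_v s$ and $t\varphi_e=\varphi_v t$; $\operatorname{Aut}(G)$ is the group of automorphisms. The identity $\mathrm{id}_G$ is the pair of identity maps (so an automorphism that fixes all vertices but moves some edge is not the identity). A coloring of $G$ is a map $\chi:E\to[k]=\{1,\dots,k\}$ whose restriction to the set of outgoing edges of each vertex is a bijection onto $[k]$. It defines the deterministic complete automaton $\chi(G)=(V,[k],\delta_\chi)$, where $\delta_\chi(v,a)=t(e)$ for the unique edge $e$ with $s(e)=v$, $\chi(e)=a$. The automaton is synchronizing if there is a word $w\in[k]^*$ with $|V\cdot w|=1$. $G$ is totally synchronizing if $\chi(G)$ is synchronizing for every coloring $\chi$ of $G$. A nontrivial (i.e. $\neq\mathrm{id}_G$) automorphism $\varphi$ is vertex-rigid if for every vertex $v$ and every $m>0$, $\varphi^m(v)=v$ implies $\varphi^m(e)=e$ for all edges $e$ with source $v$. A nontrivial automorphism $\varphi$ is semiregular if for every $m>0$, $\varphi^m\ne\mathrm{id}_G$ implies that $\varphi^m$ fixes no vertex. -}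

module Defs where

open import Algebra.Bundles using (Group)
import Algebra.Definitions.RawMonoid as RawMonoidDefs
open import Data.Fin.Base using (Fin)
open import Data.Fin.Permutation
  using (Permutation′; _⟨$⟩ʳ_; _⟨$⟩ˡ_; _∘ₚ_; inverseˡ; inverseʳ)
  renaming (id to idₚ; flip to flipₚ)
open import Data.Fin.Properties using (_≟_; any?)
open import Data.Fin.Subset using (Subset; ∣_∣)
open import Data.List.Base using (List; foldl; filter; length; allFin)
open import Data.Nat.Base using (ℕ; _>_)
open import Data.Product.Base using (_×_; _,_; proj₁; proj₂; Σ; ∃)
open import Data.Vec.Base using (tabulate)
open import Function.Base using (_∘_)
open import Function.Definitions using (Bijective)
open import Level using (0ℓ)
open import Relation.Binary.Construct.Closure.ReflexiveTransitive using (Star)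
open import Relation.Binary.PropositionalEquality
  using (_≡_; refl; sym; trans; cong)
open import Relation.Nullary using (¬_)
open import Relation.Nullary.Decidable using (does)

-- The finite vertex and edge sets are taken to be Fin #V and Fin #E.
record Graph : Set where
  field
    #V #E  : ℕ
    source : Fin #E → Fin #V
    target : Fin #E → Fin #V

  V : Set
  V = Fin #V

  E : Set
  E = Fin #E

  Out : V → Set
  Out v = Σ E λ e → source e ≡ v

  outEdges : V → List E
  outEdges v = filter (λ e → source e ≟ v) (allFin #E)

  _⟶_ : V → V → Set
  u ⟶ v = Σ E λ e → source e ≡ u × target e ≡ v

IsOut : ℕ → Graph → Set
IsOut k G = ∀ v → length (outEdges v) ≡ k
  where open Graph G

StronglyConnected : Graph → Set
StronglyConnected G = ∀ u v → Star _⟶_ u v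
  where open Graph G

-- Deterministic complete automata with n states and k letters.
record Automaton (n k : ℕ) : Set where
  field
    δ : Fin n → Fin k → Fin n

  _·_ : Fin n → List (Fin k) → Fin n
  q · w = foldl δ q w

  -- The set of all q · w, where q ranges over all states.
  image : List (Fin k) → Subset n
  image w = tabulate λ p → does (any? λ q → q · w ≟ p)

  Synchronizing : Set
  Synchronizing = ∃ λ w → ∣ image w ∣ ≡ 1

record Coloring (k : ℕ) (G : Graph) : Set where
  open Graph G
  field
    χ         : E → Fin k
    bijective : ∀ v → Bijective _≡_ _≡_ (λ (o : Out v) → χ (proj₁ o))

  edge : (v : V) → Fin k → Out v
  edge v a = proj₁ (proj₂ (bijective v) a)

  automaton : Automaton #V k
  automaton = record { δ = λ v a → target (proj₁ (edge v a)) }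

TotallySynchronizing : ℕ → Graph → Set
TotallySynchronizing k G =
  (c : Coloring k G) → Automaton.Synchronizing (Coloring.automaton c)

record Automorphism (G : Graph) : Set where
  open Graph G
  field
    vertexPerm : Permutation′ #V
    edgePerm   : Permutation′ #E

  φᵥ : V → V
  φᵥ = vertexPerm ⟨$⟩ʳ_

  φₑ : E → E
  φₑ = edgePerm ⟨$⟩ʳ_

  field
    source-comm : ∀ e → source (φₑ e) ≡ φᵥ (source e)
    target-comm : ∀ e → target (φₑ e) ≡ φᵥ (target e)

module _ (G : Graph) where
  open Graph G
  open Automorphism

  -- Equality of automorphisms is equality of the two underlying maps.
  _≈ᴬ_ : Automorphism G → Automorphism G → Set
  φ ≈ᴬ ψ = (∀ v → φᵥ φ v ≡ φᵥ ψ v) × (∀ e → φₑ φ e ≡ φₑ ψ e)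

  idᴬ : Automorphism G
  idᴬ = record
    { vertexPerm  = idₚ
    ; edgePerm    = idₚ
    ; source-comm = λ _ → refl
    ; target-comm = λ _ → refl
    }

  -- φ ∘ᴬ ψ applies ψ first, whereas π ∘ₚ ρ applies π first.
  _∘ᴬ_ : Automorphism G → Automorphism G → Automorphism G
  φ ∘ᴬ ψ = record
    { vertexPerm  = vertexPerm ψ ∘ₚ vertexPerm φ
    ; edgePerm    = edgePerm ψ ∘ₚ edgePerm φ
    ; source-comm = λ e →
        trans (source-comm φ (φₑ ψ e)) (cong (φᵥ φ) (source-comm ψ e))
    ; target-comm = λ e →
        trans (target-comm φ (φₑ ψ e)) (cong (φᵥ φ) (target-comm ψ e))
    }

  _⁻¹ᴬ : Automorphism G → Automorphism G
  φ ⁻¹ᴬ = record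
    { vertexPerm  = flipₚ (vertexPerm φ)
    ; edgePerm    = flipₚ (edgePerm φ)
    ; source-comm = inverse-comm source (source-comm φ)
    ; target-comm = inverse-comm target (target-comm φ)
    }
    where
    inverse-comm : (f : E → V) → (∀ e → f (φₑ φ e) ≡ φᵥ φ (f e)) →
                   ∀ e → f (edgePerm φ ⟨$⟩ˡ e) ≡ vertexPerm φ ⟨$⟩ˡ f e
    inverse-comm f comm e =
      trans (sym (inverseˡ (vertexPerm φ)))
            (cong (vertexPerm φ ⟨$⟩ˡ_)
                  (trans (sym (comm (edgePerm φ ⟨$⟩ˡ e)))
                         (cong f (inverseʳ (edgePerm φ)))))

  ⁻¹ᴬ-cong : ∀ {φ ψ} → φ ≈ᴬ ψ → (φ ⁻¹ᴬ) ≈ᴬ (ψ ⁻¹ᴬ)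
  ⁻¹ᴬ-cong {φ} {ψ} (p , q) =
    flip-cong (vertexPerm φ) (vertexPerm ψ) p , flip-cong (edgePerm φ) (edgePerm ψ) q
    where
    flip-cong : ∀ {n} (π ρ : Permutation′ n) → (∀ i → π ⟨$⟩ʳ i ≡ ρ ⟨$⟩ʳ i) →
                ∀ i → π ⟨$⟩ˡ i ≡ ρ ⟨$⟩ˡ i
    flip-cong π ρ eq i =
      trans (sym (inverseˡ ρ))
            (cong (ρ ⟨$⟩ˡ_) (trans (sym (eq (π ⟨$⟩ˡ i))) (inverseʳ π)))

  Aut : Group 0ℓ 0ℓ
  Aut = record
    { Carrier = Automorphism G
    ; _≈_     = _≈ᴬ_
    ; _∙_     = _∘ᴬ_
    ; ε       = idᴬ
    ; _⁻¹     = _⁻¹ᴬ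
    ; isGroup = record
      { isMonoid = record
        { isSemigroup = record
          { isMagma = record
            { isEquivalence = record
              { refl  = (λ _ → refl) , (λ _ → refl)
              ; sym   = λ (p , q) → (sym ∘ p) , (sym ∘ q)
              ; trans = λ (p , q) (p′ , q′) →
                  (λ v → trans (p v) (p′ v)) , (λ e → trans (q e) (q′ e))
              }
            ; ∙-cong = λ {φ} {φ′} {ψ} {ψ′} (p , q) (p′ , q′) →
                (λ v → trans (cong (φᵥ φ) (p′ v)) (p (φᵥ ψ′ v))) ,
                (λ e → trans (cong (φₑ φ) (q′ e)) (q (φₑ ψ′ e)))
            }
          ; assoc = λ _ _ _ → (λ _ → refl) , (λ _ → refl)
          }
        ; identity = (λ _ → (λ _ → refl) , (λ _ → refl)) ,
                     (λ _ → (λ _ → refl) , (λ _ → refl))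
        }
      ; inverse =
          (λ φ → (λ _ → inverseˡ (vertexPerm φ)) , (λ _ → inverseˡ (edgePerm φ))) ,
          (λ φ → (λ _ → inverseʳ (vertexPerm φ)) , (λ _ → inverseʳ (edgePerm φ)))
      ; ⁻¹-cong = λ {φ} {ψ} → ⁻¹ᴬ-cong {φ} {ψ}
      }
    }

module _ {G : Graph} where
  open Graph G
  open Automorphism
  open Group (Aut G) using (_≈_; ε)

  infixr 8 _^_

  -- The library writes powers in a monoid additively, as m × φ.
  _^_ : Automorphism G → ℕ → Automorphism G
  φ ^ m = RawMonoidDefs._×_ (Group.rawMonoid (Aut G)) m φ

  Nontrivial : Automorphism G → Set
  Nontrivial φ = ¬ (φ ≈ ε)

  VertexRigid : Automorphism G → Set
  VertexRigid φ =
    Nontrivial φ ×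
    (∀ v m → m > 0 → φᵥ (φ ^ m) v ≡ v →
     ∀ e → source e ≡ v → φₑ (φ ^ m) e ≡ e)

  Semiregular : Automorphism G → Set
  Semiregular φ =
    Nontrivial φ ×
    (∀ m → m > 0 → Nontrivial (φ ^ m) → ¬ (∃ λ v → φᵥ (φ ^ m) v ≡ v))

{-# OPTIONS --safe #-}
module Submission where

-- A vertex-rigid automorphism φ leaves some coloring invariant: color the
-- outgoing edges of one vertex in each φ-orbit arbitrarily and transport the
-- colors along the orbit, which is unambiguous by rigidity.  Then φ commutes
-- with the action of words, so it fixes the state reached by a synchronizing
-- word.  By rigidity φ fixes all edges leaving a fixed vertex, hence their
-- targets, and strong connectivity forces φ = id.  A semiregular automorphism
-- is vertex-rigid.

open import Defs
open import Algebra.Bundles using (Group)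
import Algebra.Properties.Monoid.Mult as Mult
open import Data.Fin.Base using (Fin; zero; suc; toℕ; cast)
open import Data.Fin.Permutation using (Permutation′; _⟨$⟩ʳ_; _⟨$⟩ˡ_; inverseʳ)
open import Data.Fin.Properties
  using (_≟_; any?; pigeonhole; toℕ≤pred[n]; cast-involutive)
open import Data.Fin.Subset using (Subset; ∣_∣; ⁅_⁆; _∈_)
open import Data.Fin.Subset.Properties using (x∈⁅y⁆⇒x≡y; ∣⁅x⁆∣≡1; p⊂q⇒∣p∣<∣q∣)
open import Data.List.Base as List using (List; []; _∷_; allFin; filter)
open import Data.List.Membership.Propositional using () renaming (_∈_ to _∈ˡ_)
open import Data.List.Membership.Propositional.Properties
  using (∈-filter⁺; ∈-filter⁻; ∈-allFin; ∈-lookup)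
open import Data.List.Properties using (filter-≐)
open import Data.List.Relation.Unary.All as All using ()
open import Data.List.Relation.Unary.AllPairs using (_∷_)
open import Data.List.Relation.Unary.Any using (here; there; index)
open import Data.List.Relation.Unary.Any.Properties using (lookup-index)
open import Data.List.Relation.Unary.Unique.Propositional using (Unique)
open import Data.List.Relation.Unary.Unique.Propositional.Properties using (filter⁺; allFin⁺)
open import Data.Nat.Base using (ℕ; zero; suc; _+_; _∸_; _≤_; _<_; z<s)
open import Data.Nat.Properties
  using (+-comm; +-suc; m≤n+m; m+[n∸m]≡n; m∸n+n≡m; m<n⇒0<n∸m; n<1+n; ≤-trans; ≤-reflexive;
         <-irrefl; <⇒≤; m≤n⇒m<n∨m≡n; ≤-total; ∸-monoʳ-<; anyUpTo?)
open import Data.Product.Base using (_×_; _,_; proj₁; proj₂; ∃; Σ-syntax)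
open import Data.Sum.Base using (inj₁; inj₂)
open import Data.Vec.Properties using (lookup∘tabulate; lookup⇒[]=)
open import Function.Bundles using (Injection)
open import Function.Properties.Inverse using (↔⇒↣)
open import Relation.Binary.Construct.Closure.ReflexiveTransitive using (Star; ε; _◅_)
open import Relation.Binary.PropositionalEquality
  using (_≡_; refl; sym; trans; cong; subst; module ≡-Reasoning)
open import Relation.Nullary using (¬_; Dec; contradiction)
open import Relation.Nullary.Decidable using (dec-true; decidable-stable)

-- Permutations, one-element subsets and positions in lists.

permutation-injective : ∀ {n} (π : Permutation′ n) {i j} → π ⟨$⟩ʳ i ≡ π ⟨$⟩ʳ j → i ≡ j
permutation-injective π = Injection.injective (↔⇒↣ π)

-- If `x` and `y` differed, `⁅ x ⁆` would be a proper subset of `p` and hence of smaller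
-- cardinality.
∣p∣≡1⇒x≡y : ∀ {n} {p : Subset n} {x y} → ∣ p ∣ ≡ 1 → x ∈ p → y ∈ p → x ≡ y
∣p∣≡1⇒x≡y {p = p} {x} {y} ∣p∣≡1 x∈p y∈p = decidable-stable (x ≟ y) λ x≢y →
  <-irrefl (trans (∣⁅x⁆∣≡1 x) (sym ∣p∣≡1))
    (p⊂q⇒∣p∣<∣q∣ {p = ⁅ x ⁆} {q = p}
      ( (λ z∈⁅x⁆ → subst (_∈ p) (sym (x∈⁅y⁆⇒x≡y x z∈⁅x⁆)) x∈p)
      , y , y∈p , λ y∈⁅x⁆ → x≢y (sym (x∈⁅y⁆⇒x≡y x y∈⁅x⁆))))

module _ {A : Set} where

  index-lookup : ∀ {xs : List A} → Unique xs → ∀ i (p : List.lookup xs i ∈ˡ xs) → index p ≡ i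
  index-lookup (_  ∷ _)  zero    (here _)   = refl
  index-lookup (x∉ ∷ _)  zero    (there p)  = contradiction refl (All.lookup x∉ p)
  index-lookup (x∉ ∷ _)  (suc i) (here eq)  = contradiction (sym eq) (All.lookup x∉ (∈-lookup i))
  index-lookup (_  ∷ xs) (suc i) (there p)  = cong suc (index-lookup xs i p)

  index-injective : ∀ {xs : List A} {x y} (p : x ∈ˡ xs) (q : y ∈ˡ xs) → index p ≡ index q → x ≡ y
  index-injective {xs} p q eq =
    trans (lookup-index p) (trans (cong (List.lookup xs) eq) (sym (lookup-index q)))

  -- The membership proof only rules out the empty list; the chosen element depends on the list
  -- alone.
  firstOf : ∀ {xs : List A} {x} → x ∈ˡ xs → ∃ (_∈ˡ xs)
  firstOf {y ∷ _} _ = y , here refl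

  firstOf-cong : ∀ {xs ys : List A} {x y} (p : x ∈ˡ xs) (q : y ∈ˡ ys) →
                 xs ≡ ys → proj₁ (firstOf p) ≡ proj₁ (firstOf q)
  firstOf-cong {_ ∷ _} p q refl = refl

image-∈ : ∀ {n k} (A : Automaton n k) w q → Automaton._·_ A q w ∈ Automaton.image A w
image-∈ A w q = lookup⇒[]= (q · w) (image w)
  (trans (lookup∘tabulate _ (q · w)) (dec-true (any? λ r → r · w ≟ q · w) (q , refl)))
  where open Automaton A

-- Construction and transport of colorings.

module _ {k : ℕ} {G : Graph} where
  open Graph G

  module _ (c : Coloring k G) where
    open Coloring c

    χ-injective : ∀ {e f} → source e ≡ source f → χ e ≡ χ f → e ≡ f
    χ-injective {e} {f} s eq = cong proj₁ (proj₁ (bijective (source f)) {e , s} {f , refl} eq)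

    χ-edge : ∀ v a → χ (proj₁ (edge v a)) ≡ a
    χ-edge v a = proj₂ (proj₂ (bijective v) a) refl

  mkColoring : (χ : E → Fin k) →
               (∀ {e f} → source e ≡ source f → χ e ≡ χ f → e ≡ f) →
               (∀ v a → Σ[ e ∈ E ] source e ≡ v × χ e ≡ a) → Coloring k G
  mkColoring χ injective surjective = record
    { χ         = χ
    ; bijective = λ v →
        (λ {(e , s)} {(f , t)} eq → Out-≡ s t (injective (trans s (sym t)) eq)) ,
        λ a → let e , s , eq = surjective v a in (e , s) , λ { refl → eq }
    }
    where
    Out-≡ : ∀ {v e f} (s : source e ≡ v) (t : source f ≡ v) → e ≡ f →
            _≡_ {A = Out v} (e , s) (f , t)
    Out-≡ refl refl refl = refl

  -- An edge gets its position in the list of edges leaving its source. The out-degree `k` bounds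
  -- this position, and as the list has no repetitions, each position is the color of the edge
  -- standing there.
  coloring : IsOut k G → Coloring k G
  coloring isOut = mkColoring χ injective surjective
    where
    ∈-outEdges : ∀ e → e ∈ˡ outEdges (source e)
    ∈-outEdges e = ∈-filter⁺ (λ f → source f ≟ source e) (∈-allFin e) refl

    ∈-outEdges′ : ∀ {e v} → source e ≡ v → e ∈ˡ outEdges v
    ∈-outEdges′ {e} refl = ∈-outEdges e

    χ : E → Fin k
    χ e = cast (isOut (source e)) (index (∈-outEdges e))

    χ-cast : ∀ {e v} (s : source e ≡ v) → cast (isOut v) (index (∈-outEdges′ s)) ≡ χ e
    χ-cast refl = refl

    cast-injective : ∀ {m n} .(eq : m ≡ n) {i j : Fin m} → cast eq i ≡ cast eq j → i ≡ j
    cast-injective eq {i} {j} p =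
      trans (sym (cast-involutive (sym eq) eq i))
            (trans (cong (cast (sym eq)) p) (cast-involutive (sym eq) eq j))

    injective : ∀ {e f} → source e ≡ source f → χ e ≡ χ f → e ≡ f
    injective {e} {f} s eq = index-injective (∈-outEdges′ s) (∈-outEdges f)
      (cast-injective (isOut (source f)) (trans (χ-cast s) eq))

    surjective : ∀ v a → Σ[ e ∈ E ] source e ≡ v × χ e ≡ a
    surjective v a = e , s , (begin
      χ e                                      ≡⟨ χ-cast s ⟨
      cast (isOut v) (index (∈-outEdges′ s))   ≡⟨ cong (cast (isOut v)) (index-lookup unique i (∈-outEdges′ s)) ⟩
      cast (isOut v) i                         ≡⟨ cast-involutive (isOut v) (sym (isOut v)) a ⟩
      a                                        ∎)
      where
      open ≡-Reasoning
      i = cast (sym (isOut v)) a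
      e = List.lookup (outEdges v) i
      s : source e ≡ v
      s = proj₂ (∈-filter⁻ (λ f → source f ≟ v) {xs = allFin #E} (∈-lookup {xs = outEdges v} i))
      unique : Unique (outEdges v)
      unique = filter⁺ (λ f → source f ≟ v) (allFin⁺ #E)

  -- Whatever the choice of `ψ`, the automorphism `ψ v` carries the edges leaving `v` bijectively
  -- onto those leaving its image, so colors can be pulled back independently at each vertex.
  transport : Coloring k G → (V → Automorphism G) → Coloring k G
  transport c ψ = mkColoring χ′ injective surjective
    where
    open Coloring c
    open Automorphism

    χ′ : E → Fin k
    χ′ e = χ (φₑ (ψ (source e)) e)

    injective : ∀ {e f} → source e ≡ source f → χ′ e ≡ χ′ f → e ≡ f
    injective {e} {f} s eq = permutation-injective (edgePerm (ψ (source f)))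
      (χ-injective c
        (trans (source-comm ψf e) (trans (cong (φᵥ ψf) s) (sym (source-comm ψf f))))
        (subst (λ v → χ (φₑ (ψ v) e) ≡ χ (φₑ ψf f)) s eq))
      where ψf = ψ (source f)

    surjective : ∀ v a → Σ[ e ∈ E ] source e ≡ v × χ′ e ≡ a
    surjective v a = e , s , (begin
      χ (φₑ (ψ (source e)) e)  ≡⟨ cong (λ u → χ (φₑ (ψ u) e)) s ⟩
      χ (φₑ (ψ v) e)           ≡⟨ cong χ (inverseʳ (edgePerm (ψ v))) ⟩
      χ (proj₁ o)              ≡⟨ χ-edge c (φᵥ (ψ v) v) a ⟩
      a                        ∎)
      where
      open ≡-Reasoning
      o = edge (φᵥ (ψ v) v) a
      e = edgePerm (ψ v) ⟨$⟩ˡ proj₁ o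
      s : source e ≡ v
      s = permutation-injective (vertexPerm (ψ v)) (begin
        φᵥ (ψ v) (source e)  ≡⟨ source-comm (ψ v) e ⟨
        source (φₑ (ψ v) e)  ≡⟨ cong source (inverseʳ (edgePerm (ψ v))) ⟩
        source (proj₁ o)     ≡⟨ proj₂ o ⟩
        φᵥ (ψ v) v           ∎)

  -- Equivariance of the automaton under a color-preserving automorphism.

  module _ (c : Coloring k G) (φ : Automorphism G) where
    open Coloring c
    open Automorphism φ
    open Automaton automaton

    module _ (χ-invariant : ∀ e → χ (φₑ e) ≡ χ e) where

      -- The image of the `a`-edge at `v` leaves `φᵥ v` and has color `a`; only one edge does.
      δ-equivariant : ∀ v a → φᵥ (δ v a) ≡ δ (φᵥ v) a
      δ-equivariant v a = trans (sym (target-comm e)) (cong target (χ-injective c s eq))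
        where
        e = proj₁ (edge v a)
        s : source (φₑ e) ≡ source (proj₁ (edge (φᵥ v) a))
        s = trans (source-comm e)
                  (trans (cong φᵥ (proj₂ (edge v a))) (sym (proj₂ (edge (φᵥ v) a))))
        eq : χ (φₑ e) ≡ χ (proj₁ (edge (φᵥ v) a))
        eq = trans (χ-invariant e) (trans (χ-edge c v a) (sym (χ-edge c (φᵥ v) a)))

      ·-equivariant : ∀ w v → φᵥ (v · w) ≡ φᵥ v · w
      ·-equivariant []      v = refl
      ·-equivariant (a ∷ w) v =
        trans (·-equivariant w (δ v a)) (cong (_· w) (δ-equivariant v a))

      -- By equivariance `φᵥ (v · w)` is again a state reached by `w`, and `w` reaches only one.
      synchronized-fixed : ∀ w → ∣ image w ∣ ≡ 1 → ∀ v → φᵥ (v · w) ≡ v · w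
      synchronized-fixed w eq v = trans (·-equivariant w v)
        (∣p∣≡1⇒x≡y eq (image-∈ automaton w (φᵥ v)) (image-∈ automaton w v))

-- Powers of an automorphism and representatives of vertex orbits.

module _ {G : Graph} (φ : Automorphism G) where
  open Graph G
  open Automorphism
  open Mult (Group.monoid (Aut G)) using (×-homo-+)

  φᵥ-^-+ : ∀ m n v → φᵥ (φ ^ (m + n)) v ≡ φᵥ (φ ^ m) (φᵥ (φ ^ n) v)
  φᵥ-^-+ m n = proj₁ (×-homo-+ φ m n)

  φₑ-^-+ : ∀ m n e → φₑ (φ ^ (m + n)) e ≡ φₑ (φ ^ m) (φₑ (φ ^ n) e)
  φₑ-^-+ m n = proj₂ (×-homo-+ φ m n)

  -- A power unfolds with the extra `φ` applied last; here it is applied first.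
  φᵥ-^-suc : ∀ m v → φᵥ (φ ^ suc m) v ≡ φᵥ (φ ^ m) (φᵥ φ v)
  φᵥ-^-suc m v = trans (cong (λ n → φᵥ (φ ^ n) v) (+-comm 1 m)) (φᵥ-^-+ m 1 v)

  φₑ-^-suc : ∀ m e → φₑ (φ ^ suc m) e ≡ φₑ (φ ^ m) (φₑ φ e)
  φₑ-^-suc m e = trans (cong (λ n → φₑ (φ ^ n) e) (+-comm 1 m)) (φₑ-^-+ m 1 e)

  period : ∀ v → ∃ λ p → p < #V × φᵥ (φ ^ suc p) v ≡ v
  period v with pigeonhole (n<1+n #V) (λ i → φᵥ (φ ^ toℕ i) v)
  -- Two of the `#V + 1` iterates agree; cancelling `φ ^ toℕ i` leaves the positive exponent
  -- `toℕ j ∸ toℕ i`, which is `suc p`.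
  ... | i , j , i<j , eq = p , p<#V , permutation-injective (vertexPerm (φ ^ toℕ i)) (begin
    φᵥ (φ ^ toℕ i) (φᵥ (φ ^ suc p) v)  ≡⟨ φᵥ-^-+ (toℕ i) (suc p) v ⟨
    φᵥ (φ ^ (toℕ i + suc p)) v         ≡⟨ cong (λ n → φᵥ (φ ^ n) v) i+1+p≡j ⟩
    φᵥ (φ ^ toℕ j) v                   ≡⟨ eq ⟨
    φᵥ (φ ^ toℕ i) v                   ∎)
    where
    open ≡-Reasoning
    p = toℕ j ∸ suc (toℕ i)
    i+1+p≡j : toℕ i + suc p ≡ toℕ j
    i+1+p≡j = trans (+-suc (toℕ i) p) (m+[n∸m]≡n i<j)
    p<#V : p < #V
    p<#V = ≤-trans (m≤n+m (suc p) (toℕ i)) (≤-trans (≤-reflexive i+1+p≡j) (toℕ≤pred[n] j))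

  -- The bound on the exponent makes reachability along the orbit decidable.
  Reach : V → V → Set
  Reach v u = ∃ λ m → m < #V × φᵥ (φ ^ m) v ≡ u

  reach? : ∀ v u → Dec (Reach v u)
  reach? v u = anyUpTo? (λ m → φᵥ (φ ^ m) v ≟ u) #V

  -- Only the exponent `#V` is out of range; subtracting a period, which is positive and at most
  -- `#V`, brings it back.
  reach-≤ : ∀ {m v u} → m ≤ #V → φᵥ (φ ^ m) v ≡ u → Reach v u
  reach-≤ {m} {v} m≤#V eq with m≤n⇒m<n∨m≡n m≤#V
  ... | inj₁ m<#V = m , m<#V , eq
  ... | inj₂ refl with p , p<#V , fix ← period v =
    r , ∸-monoʳ-< z<s p<#V , (begin
      φᵥ (φ ^ r) v                    ≡⟨ cong (φᵥ (φ ^ r)) fix ⟨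
      φᵥ (φ ^ r) (φᵥ (φ ^ suc p) v)   ≡⟨ φᵥ-^-+ r (suc p) v ⟨
      φᵥ (φ ^ (r + suc p)) v          ≡⟨ cong (λ n → φᵥ (φ ^ n) v) (m∸n+n≡m p<#V) ⟩
      φᵥ (φ ^ #V) v                   ≡⟨ eq ⟩
      _                               ∎)
    where
    open ≡-Reasoning
    r = #V ∸ suc p

  reach-refl : ∀ v → Reach v v
  reach-refl v = let p , p<#V , fix = period v in reach-≤ p<#V fix

  reach-φ⁺ : ∀ {v u} → Reach v u → Reach (φᵥ φ v) u
  reach-φ⁺ {v} (suc m , m<#V , eq) = m , <⇒≤ m<#V , trans (sym (φᵥ-^-suc m v)) eq
  -- Here `u` is `v` itself, and `p` further steps from `φᵥ φ v` close the cycle.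
  reach-φ⁺ {v} (zero  , _    , refl) =
    let p , p<#V , fix = period v in p , p<#V , trans (sym (φᵥ-^-suc p v)) fix

  reach-φ⁻ : ∀ {v u} → Reach (φᵥ φ v) u → Reach v u
  reach-φ⁻ {v} (m , m<#V , eq) = reach-≤ m<#V (trans (φᵥ-^-suc m v) eq)

  -- Filtering `allFin #V` lists an orbit in a fixed order, so `v` and `φᵥ φ v` get the same list
  -- and hence the same first element.
  orbit : V → List V
  orbit v = filter (reach? v) (allFin #V)

  orbit-φ : ∀ v → orbit (φᵥ φ v) ≡ orbit v
  orbit-φ v = filter-≐ (reach? (φᵥ φ v)) (reach? v) (reach-φ⁻ , reach-φ⁺) (allFin #V)

  ∈-orbit : ∀ v → v ∈ˡ orbit v
  ∈-orbit v = ∈-filter⁺ (reach? v) (∈-allFin v) (reach-refl v)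

  representative : V → V
  representative v = proj₁ (firstOf (∈-orbit v))

  representative-φ : ∀ v → representative (φᵥ φ v) ≡ representative v
  representative-φ v = firstOf-cong (∈-orbit (φᵥ φ v)) (∈-orbit v) (orbit-φ v)

  reach-representative : ∀ v → Reach v (representative v)
  reach-representative v =
    proj₂ (∈-filter⁻ (reach? v) {xs = allFin #V} (proj₂ (firstOf (∈-orbit v))))

  exponent : V → ℕ
  exponent v = proj₁ (reach-representative v)

  φ^exponent : ∀ v → φᵥ (φ ^ exponent v) v ≡ representative v
  φ^exponent v = proj₂ (proj₂ (reach-representative v))

  -- Vertex-rigid automorphisms and their invariant colorings.

  module _ (rigid : VertexRigid φ) where

    -- The power `φ ^ (n ∸ m)` fixes the vertex `φᵥ (φ ^ m) (source e)`, so rigidity there makes it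
    -- fix the edge `φₑ (φ ^ m) e`.
    rigid-≤ : ∀ {m n} → m ≤ n → ∀ e → φᵥ (φ ^ m) (source e) ≡ φᵥ (φ ^ n) (source e) →
              φₑ (φ ^ m) e ≡ φₑ (φ ^ n) e
    rigid-≤ {m} {n} m≤n e eq with m≤n⇒m<n∨m≡n m≤n
    ... | inj₂ refl = refl
    ... | inj₁ m<n = begin
      φₑ (φ ^ m) e              ≡⟨ proj₂ rigid w d (m<n⇒0<n∸m m<n) fix (φₑ (φ ^ m) e) (source-comm (φ ^ m) e) ⟨
      φₑ (φ ^ d) (φₑ (φ ^ m) e) ≡⟨ φₑ-^-+ d m e ⟨
      φₑ (φ ^ (d + m)) e        ≡⟨ cong (λ i → φₑ (φ ^ i) e) (m∸n+n≡m m≤n) ⟩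
      φₑ (φ ^ n) e              ∎
      where
      open ≡-Reasoning
      d = n ∸ m
      w = φᵥ (φ ^ m) (source e)
      fix : φᵥ (φ ^ d) w ≡ w
      fix = begin
        φᵥ (φ ^ d) w                  ≡⟨ φᵥ-^-+ d m (source e) ⟨
        φᵥ (φ ^ (d + m)) (source e)   ≡⟨ cong (λ i → φᵥ (φ ^ i) (source e)) (m∸n+n≡m m≤n) ⟩
        φᵥ (φ ^ n) (source e)         ≡⟨ eq ⟨
        w                             ∎

    rigid-^ : ∀ m n e → φᵥ (φ ^ m) (source e) ≡ φᵥ (φ ^ n) (source e) →
              φₑ (φ ^ m) e ≡ φₑ (φ ^ n) e
    rigid-^ m n e eq with ≤-total m n
    ... | inj₁ m≤n = rigid-≤ m≤n e eq
    ... | inj₂ n≤m = sym (rigid-≤ n≤m e (sym eq))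

    module _ {k : ℕ} (c : Coloring k G) where

      -- An edge takes the color of its image at the representative of the orbit of its source.
      invariantColoring : Coloring k G
      invariantColoring = transport c (λ v → φ ^ exponent v)

      -- The color of `φₑ φ e` comes from applying `φ ^ suc n` to `e`, that of `e` from
      -- `φ ^ exponent v`. The exponents may differ, but both powers send `v` to the same
      -- representative, so by rigidity they agree on `e`.
      invariantColoring-invariant :
        ∀ e → Coloring.χ invariantColoring (φₑ φ e) ≡ Coloring.χ invariantColoring e
      invariantColoring-invariant e = cong (Coloring.χ c) (begin
        φₑ (φ ^ exponent (source (φₑ φ e))) (φₑ φ e)
          ≡⟨ cong (λ u → φₑ (φ ^ exponent u) (φₑ φ e)) (source-comm φ e) ⟩
        φₑ (φ ^ n) (φₑ φ e)       ≡⟨ φₑ-^-suc n e ⟨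
        φₑ (φ ^ suc n) e          ≡⟨ rigid-^ (suc n) (exponent v) e same-vertex ⟩
        φₑ (φ ^ exponent v) e     ∎)
        where
        open ≡-Reasoning
        v = source e
        n = exponent (φᵥ φ v)
        same-vertex : φᵥ (φ ^ suc n) v ≡ φᵥ (φ ^ exponent v) v
        same-vertex = begin
          φᵥ (φ ^ suc n) v          ≡⟨ φᵥ-^-suc n v ⟩
          φᵥ (φ ^ n) (φᵥ φ v)       ≡⟨ φ^exponent (φᵥ φ v) ⟩
          representative (φᵥ φ v)   ≡⟨ representative-φ v ⟩
          representative v          ≡⟨ φ^exponent v ⟨
          φᵥ (φ ^ exponent v) v     ∎

    rigid-edge : ∀ {v} → φᵥ φ v ≡ v → ∀ e → source e ≡ v → φₑ φ e ≡ e
    rigid-edge {v} = proj₂ rigid v 1 z<s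

    -- Rigidity at a fixed source fixes the edge and with it the target, so fixedness spreads along
    -- paths.
    rigid-path : ∀ {u v} → Star _⟶_ u v → φᵥ φ u ≡ u → φᵥ φ v ≡ v
    rigid-path ε fix = fix
    rigid-path ((e , s , refl) ◅ path) fix = rigid-path path
      (trans (sym (target-comm φ e)) (cong target (rigid-edge fix e s)))

  -- If a power fixing `v` moved an edge, it would be a nontrivial power with a fixed vertex.
  semiregular⇒vertexRigid : Semiregular φ → VertexRigid φ
  semiregular⇒vertexRigid (nontrivial , fixedPointFree) =
    nontrivial , λ v m m>0 fix e _ → decidable-stable (φₑ (φ ^ m) e ≟ e)
      λ moved → fixedPointFree m m>0 (λ trivial → moved (proj₂ trivial e)) (v , fix)

-- Triviality of rigid automorphisms of totally synchronizing graphs.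

¬vertexRigid : ∀ {k G} → IsOut k G → StronglyConnected G → TotallySynchronizing k G →
               (φ : Automorphism G) → ¬ VertexRigid φ
¬vertexRigid {k} {G} isOut connected synchronizing φ rigid =
  proj₁ rigid (fixed , λ e → rigid-edge φ rigid (fixed (source e)) e refl)
  where
  open Graph G
  open Automorphism φ

  c : Coloring k G
  c = invariantColoring φ rigid (coloring isOut)

  open Automaton (Coloring.automaton c)

  fixed : ∀ v → φᵥ v ≡ v
  fixed v = let w , eq = synchronizing c in
    -- The synchronized state `v · w` is fixed by `φ`, and a path leads from it back to `v`.
    rigid-path φ rigid (connected (v · w) v)
      (synchronized-fixed c φ (invariantColoring-invariant φ rigid (coloring isOut)) w eq v)

theorem3p9 : (k : ℕ) (G : Graph) → IsOut k G → StronglyConnected G → TotallySynchronizing k G →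
    (¬ (Σ[ φ ∈ Group.Carrier (Aut G) ] VertexRigid φ)) × (¬ (Σ[ φ ∈ Group.Carrier (Aut G) ] Semiregular φ))
theorem3p9 k G isOut connected synchronizing =
  (λ (φ , rigid) → noRigid φ rigid) ,
  λ (φ , semiregular) → noRigid φ (semiregular⇒vertexRigid φ semiregular)
  where noRigid = ¬vertexRigid isOut connected synchronizing
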